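{- (1) $\kappa^0(C_l^2)\geqslant 4/9$ for all integers $l\geqslant 5$ with $l\not\equiv 0\pmod 6$, and $\kappa^0(P_l^2)\geqslant 3/8$ for all integers $l\geqslant 7$. (2) Moreover, for each $l\geqslant 5$ with $l\not\equiv 0\pmod 6$ there exist, for arbitrarily large $n$, $n$-vertex $4n/9$-regular oriented graphs containing no copy of $C_l^2$; and for each $l\geqslant 7$ there exist, for arbitrarily large $n$, $n$-vertex $3n/8$-regular oriented graphs containing no copy of $P_l^2$.
   Context: An oriented graph is a digraph without loops, parallel edges, or 2-cycles; it is $d$-regular if every vertex has in-degree $d$ and out-degree $d$. $\delta^0(G)$ is the minimum of all in-degrees and out-degrees of vertices of $G$. $C_l$ is the directed cycle on $l$ vertices and $P_l$ is the directed path on $l$ vertices. For a directed path or cycle $L$, the square $L^2$ is the digraph obtained from $L$ by adding a directed edge from $x$ to $y$ whenever there is a directed path of length at most $2$ from $x$ to $y$ on $L$. For an oriented graph $H$, $g(n,H)$ is the smallest number such that every $n$-vertex oriented graph $G$ with $\delta^0(G)\geqslant g(n,H)$ contains a copy of $H$, and $\kappa^0(H)=\lim_{n\to\infty} g(n,H)/n$. -}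

module Defs where

open import Data.Bool using (true)
open import Data.Fin using (Fin; toℕ)
open import Data.Fin.Properties as Fin using (any?; all?)
open import Data.Fin.Subset using (Subset) renaming (_∈_ to _∈ₛ_)
open import Data.Fin.Subset.Properties using (_∈?_; anySubset?)
open import Data.Integer using (+_)
open import Data.List using (List; length; filter; map; allFin; _++_)
open import Data.List.Extrema.Nat using (min; min≤⊤)
open import Data.List.Properties using (filter-≐; map-cong)
open import Data.Nat using (ℕ; zero; suc; _≤_; _≤?_; z≤n; s≤s)
open import Data.Nat.Properties as ℕ using (≤-trans; 1+n≰n)
open import Data.Product using (_×_; _,_; ∃; proj₁; proj₂)
open import Data.Rational as ℚ using (ℚ; 0ℚ)
open import Data.Sum using (_⊎_)
open import Data.Vec using (Vec; []; _∷_; lookup; tabulate)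
open import Data.Vec.Properties using (lookup∘tabulate; lookup⇒[]=; []=⇒lookup)
open import Function.Definitions using (Injective)
open import Level using (0ℓ)
open import Relation.Binary using (Rel; Decidable; Asymmetric)
open import Relation.Binary.PropositionalEquality
  using (_≡_; _≢_; refl; sym; trans; cong; cong₂; subst; subst₂)
open import Relation.Nullary using (¬_; Dec; yes; no; does)
open import Relation.Nullary.Decidable
  using (map′; ¬?; _×-dec_; _⊎-dec_; _→-dec_; decidable-stable; dec-true)
open import Relation.Nullary.Negation using (contradiction)
open import Relation.Unary as U using ()

------------------------------------------------------------------------
-- Digraphs

record Digraph (n : ℕ) : Set₁ where
  field
    Edge  : Rel (Fin n) 0ℓ
    edge? : Decidable Edge

open Digraph public

-- Asymmetry rules out 2-cycles and (taking both ends equal) loops;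
-- parallel edges do not exist because Edge is a relation.
Oriented : ∀ {n} → Digraph n → Set
Oriented G = Asymmetric (Edge G)

outdeg indeg : ∀ {n} → Digraph n → Fin n → ℕ
outdeg G v = length (filter (λ w → edge? G v w) (allFin _))
indeg  G v = length (filter (λ u → edge? G u v) (allFin _))

Regular : ∀ {n} → ℕ → Digraph n → Set
Regular d G = ∀ v → indeg G v ≡ d × outdeg G v ≡ d

degrees : ∀ {n} → Digraph n → List ℕ
degrees {n} G = map (indeg G) (allFin n) ++ map (outdeg G) (allFin n)

-- Degrees never exceed n, so the default value n matters only for n = 0.
δ⁰ : ∀ {n} → Digraph n → ℕ
δ⁰ {n} G = min n (degrees G)

-- Copies are subgraphs, not necessarily induced.
Contains : ∀ {k n} → Digraph k → Digraph n → Set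
Contains {k} {n} H G =
  ∃ λ (f : Fin k → Fin n) →
    Injective _≡_ _≡_ f × (∀ i j → Edge H i j → Edge G (f i) (f j))

-- For l ≥ 2 this is the directed cycle 0 → 1 → … → l-1 → 0.
cycle : ∀ l → Digraph l
cycle l .Edge  u v = toℕ v ≡ suc (toℕ u) ⊎ (suc (toℕ u) ≡ l × toℕ v ≡ 0)
cycle l .edge? u v =
  (toℕ v ℕ.≟ suc (toℕ u)) ⊎-dec ((suc (toℕ u) ℕ.≟ l) ×-dec (toℕ v ℕ.≟ 0))

path : ∀ l → Digraph l
path l .Edge  u v = toℕ v ≡ suc (toℕ u)
path l .edge? u v = toℕ v ℕ.≟ suc (toℕ u)

square : ∀ {l} → Digraph l → Digraph l
square L .Edge  u v =
  Edge L u v ⊎ (u ≢ v × ∃ λ w → Edge L u w × Edge L w v)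
square L .edge? u v =
  edge? L u v ⊎-dec
    (¬? (u Fin.≟ v) ×-dec any? λ w → edge? L u w ×-dec edge? L w v)

------------------------------------------------------------------------
-- The extremal function g

Forces : ∀ {k} → Digraph k → (n d : ℕ) → Set₁
Forces H n d =
  (G : Digraph n) → Oriented G → d ≤ δ⁰ G → Contains H G

IsLeast : ∀ {ℓ} → (ℕ → Set ℓ) → ℕ → Set ℓ
IsLeast P m = P m × (∀ d → P d → m ≤ d)

private

  Searchable : Set → Set₁
  Searchable A = {P : A → Set} → U.Decidable P → Dec (∃ P)

  searchVec : ∀ {A : Set} → Searchable A → ∀ n → Searchable (Vec A n)
  searchVec s zero    P? = map′ ([] ,_) (λ { ([] , p) → p }) (P? [])
  searchVec s (suc n) P? =
    map′ (λ { (x , xs , p) → x ∷ xs , p }) (λ { (x ∷ xs , p) → x , xs , p })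
      (s λ x → searchVec s n λ xs → P? (x ∷ xs))

  searchAll : ∀ {A : Set} → Searchable A →
              {P : A → Set} → U.Decidable P → Dec (∀ x → P x)
  searchAll s P? =
    map′ (λ ¬∃ x → decidable-stable (P? x) λ ¬p → ¬∃ (x , ¬p))
         (λ ∀p (x , ¬p) → ¬p (∀p x))
         (¬? (s λ x → ¬? (P? x)))

  Matrix : ℕ → Set
  Matrix n = Vec (Subset n) n

  fromMatrix : ∀ {n} → Matrix n → Digraph n
  fromMatrix M .Edge  u v = v ∈ₛ lookup M u
  fromMatrix M .edge? u v = v ∈? lookup M u

  toMatrix : ∀ {n} → Digraph n → Matrix n
  toMatrix G = tabulate λ u → tabulate λ v → does (edge? G u v)

  does⇒ : ∀ {A : Set} (a? : Dec A) → does a? ≡ true → A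
  does⇒ (yes a) _ = a

  module _ {n} (G : Digraph n) where

    M : Digraph n
    M = fromMatrix (toMatrix G)

    entry : ∀ u v → lookup (lookup (toMatrix G) u) v ≡ does (edge? G u v)
    entry u v =
      trans (cong (λ r → lookup r v) (lookup∘tabulate _ u)) (lookup∘tabulate _ v)

    to : ∀ {u v} → Edge G u v → Edge M u v
    to {u} {v} e =
      lookup⇒[]= v _ (trans (entry u v) (dec-true (edge? G u v) e))

    from : ∀ {u v} → Edge M u v → Edge G u v
    from {u} {v} e =
      does⇒ (edge? G u v) (trans (sym (entry u v)) ([]=⇒lookup e))

    δ⁰-M : δ⁰ G ≡ δ⁰ M
    δ⁰-M = cong (min n) (cong₂ _++_
      (map-cong (λ v → cong length (filter-≐ _ _ (to , from) (allFin n))) (allFin n))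
      (map-cong (λ v → cong length (filter-≐ _ _ (to , from) (allFin n))) (allFin n)))

    contains-M : ∀ {k} {H : Digraph k} → Contains H M → Contains H G
    contains-M (f , inj , hom) = f , inj , λ i j e → from (hom i j e)

  oriented? : ∀ {n} (G : Digraph n) → Dec (Oriented G)
  oriented? G =
    map′ (λ p {x} {y} → p x y) (λ p x y → p {x} {y})
      (all? λ x → all? λ y → edge? G x y →-dec ¬? (edge? G y x))

  contains? : ∀ {k n} (H : Digraph k) (G : Digraph n) → Dec (Contains H G)
  contains? {k} {n} H G =
    map′ (λ (xs , inj , hom) → lookup xs , (λ {i} {j} → inj i j) , hom)
         (λ (f , inj , hom) →
            tabulate f
          , (λ i j eq → inj (trans (sym (lookup∘tabulate f i))
                              (trans eq (lookup∘tabulate f j))))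
          , (λ i j e → subst₂ (Edge G) (sym (lookup∘tabulate f i))
                         (sym (lookup∘tabulate f j)) (hom i j e)))
         (searchVec any? k λ xs →
            (all? λ i → all? λ j →
               (lookup xs i Fin.≟ lookup xs j) →-dec (i Fin.≟ j))
            ×-dec
            (all? λ i → all? λ j →
               edge? H i j →-dec edge? G (lookup xs i) (lookup xs j)))

  forces? : ∀ {k} (H : Digraph k) n d → Dec (Forces H n d)
  forces? H n d =
    map′ (λ p G or d≤ → contains-M G {H = H}
            (p (toMatrix G) (λ e e′ → or (from G e) (from G e′))
               (subst (d ≤_) (δ⁰-M G) d≤)))
         (λ p M → p (fromMatrix M))
         (searchAll (searchVec anySubset? n) λ M →
            oriented? (fromMatrix M) →-dec
            ((d ≤? δ⁰ (fromMatrix M)) →-dec contains? H (fromMatrix M)))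

  least : ∀ {ℓ} {P : ℕ → Set ℓ} → U.Decidable P → ∀ m → P m → ∃ (IsLeast P)
  least P? zero    p = 0 , p , λ _ _ → z≤n
  least P? (suc m) p with P? 0
  ... | yes p₀ = 0 , p₀ , λ _ _ → z≤n
  ... | no ¬p₀ with least (λ d → P? (suc d)) m p
  ...   | d , pd , d≤ = suc d , pd , λ
          { zero    q → contradiction q ¬p₀
          ; (suc e) q → s≤s (d≤ e q) }

abstract
  -- d = n + 1 forces H vacuously, since δ⁰ never exceeds n.
  threshold : ∀ {k} (H : Digraph k) n → ∃ (IsLeast (Forces H n))
  threshold H n = least (forces? H n) (suc n) λ G _ n<δ →
    contradiction (≤-trans n<δ (min≤⊤ n (degrees G))) 1+n≰n

g : ∀ {k} → ℕ → Digraph k → ℕ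
g n H = proj₁ (threshold H n)

g-isLeast : ∀ {k} n (H : Digraph k) → IsLeast (Forces H n) (g n H)
g-isLeast n H = proj₂ (threshold H n)

------------------------------------------------------------------------
-- Limits of rational sequences

-- A real number is presented by a Cauchy sequence of rationals.
record ℝ : Set where
  field
    seq    : ℕ → ℚ
    cauchy : ∀ ε → 0ℚ ℚ.< ε → ∃ λ N → ∀ m n → N ≤ m → N ≤ n →
             ℚ.∣ seq m ℚ.- seq n ∣ ℚ.≤ ε

open ℝ public

-- Since seq x n itself tends to x, the sequence a tends to x exactly when
-- a n - seq x n tends to 0.
_⟶_ : (ℕ → ℚ) → ℝ → Set
a ⟶ x = ∀ ε → 0ℚ ℚ.< ε → ∃ λ N → ∀ n → N ≤ n →
        ℚ.∣ a n ℚ.- seq x n ∣ ℚ.≤ ε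

-- q ≤ lim inf a.
_≤liminf_ : ℚ → (ℕ → ℚ) → Set
q ≤liminf a = ∀ ε → 0ℚ ℚ.< ε → ∃ λ N → ∀ n → N ≤ n → q ℚ.- ε ℚ.≤ a n

_≤ℝ_ : ℚ → ℝ → Set
q ≤ℝ x = q ≤liminf seq x

-- g(n,H)/n, with a junk value at n = 0.
ratio : ∀ {k} → Digraph k → ℕ → ℚ
ratio H zero      = 0ℚ
ratio H n@(suc _) = + g n H ℚ./ n

κ⁰_is_ : ∀ {k} → Digraph k → ℝ → Set
κ⁰ H is x = ratio H ⟶ x

-- The limit defining κ⁰ exists classically, but need not come with a
-- modulus of convergence.  The first component bounds the limit; the second
-- is the same bound without presupposing convergence, so the definition is
-- not vacuous when no x is at hand.
κ⁰_≥_ : ∀ {k} → Digraph k → ℚ → Set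
κ⁰ H ≥ q = (∀ x → κ⁰ H is x → q ≤ℝ x) × q ≤liminf ratio H

{-# OPTIONS --safe #-}

-- Both bounds come from balanced blow-ups of a small regular oriented graph B admitting no
-- homomorphism from the square.  A square walk in B is a walk whose consecutive triples are
-- transitive triangles.
-- For cycles, B is the cyclic triangle with every vertex replaced by a cyclic triangle.  In a
-- transitive triangle u → v → w exactly one of uv, vw stays inside an inner triangle, so the
-- arcs of a square walk alternate between staying and moving on; closing up takes a multiple
-- of 2 · 3 steps.
-- For paths, B is a graph on 8 vertices whose square walks have at most 4 vertices.

module Submission where

open import Defs
open import Data.Nat using (_≤_; _*_; _%_)
open import Data.Integer using (+_)
open import Data.Rational using (_/_)
open import Data.Product using (_×_; ∃)
open import Relation.Binary.PropositionalEquality using (_≡_; _≢_)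
open import Relation.Nullary using (¬_)

import Algebra.Properties.CommutativeSemigroup as CommutativeSemigroup
open import Data.Bool using (if_then_else_; true; false)
open import Data.Fin using (Fin; zero; suc; toℕ; #_; _↑ˡ_; _↑ʳ_)
open import Data.Fin.Properties as Fin using (all?; toℕ-injective; toℕ-fromℕ<; toℕ-↑ˡ; toℕ-↑ʳ; toℕ<n)
import Data.Integer as ℤ
import Data.Integer.Properties as ℤ
open import Data.List using (List; []; _∷_; _++_; length; filter; map; allFin; tabulate)
open import Data.List.Extrema.Nat using (v≤min⁺)
import Data.List.Membership.DecPropositional as DecMembership
open import Data.List.Membership.Propositional using (_∈_)
open import Data.List.Properties
  using (filter-++; length-++; length-filter; length-tabulate; map-tabulate; tabulate-cong)
import Data.List.Relation.Unary.All.Properties as All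
open import Data.Nat as ℕ using (ℕ; zero; suc; _+_; NonZero; s≤s; z≤n)
open import Data.Nat.DivMod
  using ( _mod_; %-distribˡ-+; [m+n]%n≡m%n; [m+kn]%n≡m%n; m<n⇒m%n≡m; m%n%n≡m%n; m*n%n≡0; n%n≡0
        ; m≡m%n+[m/n]*n; m%n<n; m/n*n≤m)
import Data.Nat.Properties as ℕ
open import Data.Product using (_,_; proj₁; proj₂)
open import Data.Rational as ℚ using (0ℚ; ½; mkℚ)
import Data.Rational.Properties as ℚ
open import Data.Rational.Unnormalised as ℚᵘ using (mkℚᵘ; *≤*)
import Data.Rational.Unnormalised.Properties as ℚᵘ
open import Data.Sum using (inj₁; inj₂)
open import Data.Vec as Vec using (Vec; []; _∷_)
open import Function using (_∘_)
open import Relation.Binary.PropositionalEquality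
  using (refl; sym; trans; cong; cong₂; subst; module ≡-Reasoning)
open import Relation.Nullary using (does)
open import Relation.Nullary.Decidable using (from-yes; ¬?; _×-dec_; _→-dec_)
open import Relation.Unary as U using ()

IsHom : ∀ {k n} → Digraph k → Digraph n → (Fin k → Fin n) → Set
IsHom H G f = ∀ i j → Edge H i j → Edge G (f i) (f j)

-- Balanced blow-ups

tabulate-+ : ∀ {A : Set} m {n} (f : Fin (m + n) → A) →
             tabulate f ≡ tabulate (f ∘ (_↑ˡ n)) ++ tabulate (f ∘ (m ↑ʳ_))
tabulate-+ zero    f = refl
tabulate-+ (suc m) f = cong (f zero ∷_) (tabulate-+ m (f ∘ suc))

length-filter-map : ∀ {A B : Set} {P : B → Set} (P? : U.Decidable P) (f : A → B) xs →
                    length (filter P? (map f xs)) ≡ length (filter (P? ∘ f) xs)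
length-filter-map P? f []       = refl
length-filter-map P? f (x ∷ xs) with does (P? (f x))
... | true  = cong suc (length-filter-map P? f xs)
... | false = length-filter-map P? f xs

mod-cong : ∀ d .{{_ : NonZero d}} m n → m % d ≡ n % d → m mod d ≡ n mod d
mod-cong d m n eq = toℕ-injective
  (trans (toℕ-fromℕ< (m%n<n _ d)) (trans eq (sym (toℕ-fromℕ< (m%n<n _ d)))))

toℕ-mod : ∀ {k} .{{_ : NonZero k}} (i : Fin k) → toℕ i mod k ≡ i
toℕ-mod i = toℕ-injective (trans (toℕ-fromℕ< (m%n<n _ _)) (m<n⇒m%n≡m (toℕ<n i)))

module Blowup {k} .{{_ : NonZero k}} (B : Digraph k) where

  -- Classes are residues modulo `k`, so the blow-up exists on every number of vertices, as a lower
  -- limit requires, and removing `k` vertices removes one from each class.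
  class : ∀ {n} → Fin n → Fin k
  class v = toℕ v mod k

  blowup : ∀ n → Digraph n
  blowup n .Edge  u v = Edge B (class u) (class v)
  blowup n .edge? u v = edge? B (class u) (class v)

  classes : ℕ → List (Fin k)
  classes n = map class (allFin n)

  classes-+ : ∀ n → classes (k + n) ≡ allFin k ++ classes n
  classes-+ n = begin
    classes (k + n)
      ≡⟨ map-tabulate {n = k + n} (λ i → i) class ⟩
    tabulate {n = k + n} class
      ≡⟨ tabulate-+ k {n} class ⟩
    tabulate {n = k} (λ i → class (i ↑ˡ n)) ++
      tabulate {n = n} (λ j → class (k ↑ʳ j))
      ≡⟨ cong₂ _++_ (tabulate-cong first)
           (trans (tabulate-cong rest) (sym (map-tabulate {n = n} (λ i → i) class))) ⟩
    allFin k ++ classes n ∎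
    where
    open ≡-Reasoning
    first : ∀ i → class (i ↑ˡ n) ≡ i
    first i = trans (cong (_mod k) (toℕ-↑ˡ i n)) (toℕ-mod i)
    rest : ∀ j → class (k ↑ʳ j) ≡ class j
    rest j = mod-cong k (toℕ (k ↑ʳ j)) (toℕ j) (trans
      (cong (_% k) (trans (toℕ-↑ʳ k j) (ℕ.+-comm k (toℕ j)))) ([m+n]%n≡m%n (toℕ j) k))

  module _ {P : Fin k → Set} (P? : U.Decidable P) where

    count : List (Fin k) → ℕ
    count xs = length (filter P? xs)

    count-classes-+ : ∀ n → count (classes (k + n)) ≡ count (allFin k) + count (classes n)
    count-classes-+ n = trans (cong count (classes-+ n))
      (trans (cong length (filter-++ P? (allFin k) (classes n))) (length-++ (filter P? (allFin k))))

    count-classes-* : ∀ m → count (classes (m * k)) ≡ m * count (allFin k)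
    count-classes-* zero    = refl
    count-classes-* (suc m) =
      trans (count-classes-+ (m * k)) (cong (count (allFin k) ℕ.+_) (count-classes-* m))

    -- Whole periods of `k` vertices are peeled off one by one; a last incomplete period can only
    -- add to the count.
    count-classes-≥ : ∀ m {n} → m * k ≤ n → m * count (allFin k) ≤ count (classes n)
    count-classes-≥ zero    _ = z≤n
    count-classes-≥ (suc m) le with ℕ.m≤n⇒∃[o]m+o≡n (ℕ.≤-trans (ℕ.m≤m+n k (m * k)) le)
    ... | o , refl = subst (suc m * count (allFin k) ≤_) (sym (count-classes-+ o))
      (ℕ.+-monoʳ-≤ (count (allFin k)) (count-classes-≥ m (ℕ.+-cancelˡ-≤ k _ _ le)))

  blowup-oriented : Oriented B → ∀ n → Oriented (blowup n)
  blowup-oriented or n e e′ = or e e′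

  module _ {d} (reg : Regular d B) where

    blowup-regular : ∀ m → Regular (m * d) (blowup (m * k))
    blowup-regular m v =
        trans (sym (length-filter-map _ class (allFin (m * k))))
          (trans (count-classes-* _ m) (cong (m *_) (proj₁ (reg (class v)))))
      , trans (sym (length-filter-map _ class (allFin (m * k))))
          (trans (count-classes-* _ m) (cong (m *_) (proj₂ (reg (class v)))))

    regular-degree≤order : d ≤ k
    regular-degree≤order = begin
      d                                  ≡⟨ proj₁ (reg v) ⟨
      indeg B v                          ≤⟨ length-filter (λ u → edge? B u v) (allFin k) ⟩
      length (allFin k)                  ≡⟨ length-tabulate {n = k} (λ i → i) ⟩
      k                                  ∎
      where
      open ℕ.≤-Reasoning
      v = 0 mod k

    blowup-δ⁰ : ∀ m {n} → m * k ≤ n → m * d ≤ δ⁰ (blowup n)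
    -- The default value `n` of the minimum in `δ⁰` has to be bounded as well: `m * d ≤ m * k ≤ n`.
    blowup-δ⁰ m {n} le = v≤min⁺ {xs = degrees (blowup n)} (ℕ.≤-trans (ℕ.*-monoʳ-≤ m regular-degree≤order) le)
      (All.++⁺
        (All.map⁺ {f = indeg (blowup n)} (All.tabulate⁺ {f = λ v → v} λ v →
          bound (λ u → edge? B u (class v)) (proj₁ (reg (class v)))))
        (All.map⁺ {f = outdeg (blowup n)} (All.tabulate⁺ {f = λ v → v} λ v →
          bound (edge? B (class v)) (proj₂ (reg (class v))))))
      where
      bound : ∀ {P : Fin k → Set} (P? : U.Decidable P) → length (filter P? (allFin k)) ≡ d →
              m * d ≤ length (filter (P? ∘ class) (allFin n))
      bound P? refl = subst (m * d ≤_) (length-filter-map P? class (allFin n)) (count-classes-≥ P? m le)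

-- Rational limits

p+q-q≡p : ∀ p q → (p ℚ.+ q) ℚ.- q ≡ p
p+q-q≡p p q = trans (ℚ.+-assoc p q (ℚ.- q))
  (trans (cong (p ℚ.+_) (ℚ.+-inverseʳ q)) (ℚ.+-identityʳ p))

p-q+q≡p : ∀ p q → (p ℚ.- q) ℚ.+ q ≡ p
p-q+q≡p p q = trans (ℚ.+-assoc p (ℚ.- q) q)
  (trans (cong (p ℚ.+_) (ℚ.+-inverseˡ q)) (ℚ.+-identityʳ p))

p≤q+r⇒p-r≤q : ∀ {p q r} → p ℚ.≤ q ℚ.+ r → p ℚ.- r ℚ.≤ q
p≤q+r⇒p-r≤q {p} {q} {r} le =
  subst (p ℚ.- r ℚ.≤_) (p+q-q≡p q r) (ℚ.+-monoˡ-≤ (ℚ.- r) le)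

p-r≤q⇒p≤q+r : ∀ {p q r} → p ℚ.- r ℚ.≤ q → p ℚ.≤ q ℚ.+ r
p-r≤q⇒p≤q+r {p} {q} {r} le =
  subst (ℚ._≤ q ℚ.+ r) (p-q+q≡p p r) (ℚ.+-monoˡ-≤ r le)

p≤∣p∣ : ∀ p → p ℚ.≤ ℚ.∣ p ∣
p≤∣p∣ p with ℚ.≤-total 0ℚ p
... | inj₁ 0≤p = ℚ.≤-reflexive (sym (ℚ.0≤p⇒∣p∣≡p 0≤p))
... | inj₂ p≤0 = ℚ.≤-trans p≤0 (ℚ.0≤∣p∣ p)

½*p+½*p≡p : ∀ p → ½ ℚ.* p ℚ.+ ½ ℚ.* p ≡ p
½*p+½*p≡p p = trans (sym (ℚ.*-distribʳ-+ p ½ ½)) (ℚ.*-identityˡ p)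

liminf≤limit : ∀ q a → q ≤liminf a → ∀ x → a ⟶ x → q ≤ℝ x
liminf≤limit q a q≤a x a→x ε 0<ε = M ℕ.⊔ N , bound
  where
  open ℚ.≤-Reasoning
  η = ½ ℚ.* ε
  0<η : 0ℚ ℚ.< η
  0<η = subst (ℚ._< η) (ℚ.*-zeroʳ ½) (ℚ.*-monoʳ-<-pos ½ 0<ε)
  M = proj₁ (q≤a η 0<η)
  N = proj₁ (a→x η 0<η)
  bound : ∀ n → M ℕ.⊔ N ≤ n → q ℚ.- ε ℚ.≤ seq x n
  bound n le = p≤q+r⇒p-r≤q (begin
    q
      ≤⟨ p-r≤q⇒p≤q+r (proj₂ (q≤a η 0<η) n (ℕ.m⊔n≤o⇒m≤o M N le)) ⟩
    a n ℚ.+ η                         ≡⟨ cong (ℚ._+ η) (p-q+q≡p (a n) (seq x n)) ⟨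
    (a n ℚ.- seq x n) ℚ.+ seq x n ℚ.+ η
      ≤⟨ ℚ.+-monoˡ-≤ η (ℚ.+-monoˡ-≤ (seq x n) (ℚ.≤-trans (p≤∣p∣ _)
           (proj₂ (a→x η 0<η) n (ℕ.m⊔n≤o⇒n≤o M N le)))) ⟩
    (η ℚ.+ seq x n) ℚ.+ η             ≡⟨ cong (ℚ._+ η) (ℚ.+-comm η (seq x n)) ⟩
    (seq x n ℚ.+ η) ℚ.+ η             ≡⟨ ℚ.+-assoc (seq x n) η η ⟩
    seq x n ℚ.+ (η ℚ.+ η)             ≡⟨ cong (seq x n ℚ.+_) (½*p+½*p≡p ε) ⟩
    seq x n ℚ.+ ε                     ∎)

-- Since `_/_` reduces to lowest terms, the comparison passes to unnormalised rationals, where the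
-- order is cross-multiplication itself.
/-mono-cross : ∀ a b c d .{{_ : NonZero b}} .{{_ : NonZero d}} →
               a * d ≤ c * b → + a / b ℚ.≤ + c / d
/-mono-cross a (suc b) c (suc d) le = ℚ.toℚᵘ-cancel-≤
  (ℚᵘ.≤-respʳ-≃ (ℚᵘ.≃-sym (ℚ.toℚᵘ-fromℚᵘ (mkℚᵘ (+ c) d)))
    (ℚᵘ.≤-respˡ-≃ (ℚᵘ.≃-sym (ℚ.toℚᵘ-fromℚᵘ (mkℚᵘ (+ a) b)))
      (*≤* (ℤ.≤-trans (ℤ.≤-reflexive (sym (ℤ.pos-* a (suc d))))
        (ℤ.≤-trans (ℤ.+≤+ le) (ℤ.≤-reflexive (ℤ.pos-* c (suc b))))))))

/-distrib-+ : ∀ a b n .{{_ : NonZero n}} → + a / n ℚ.+ + b / n ≡ + (a + b) / n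
/-distrib-+ a b (suc n) = ℚ.toℚᵘ-injective (begin
  ℚ.toℚᵘ (+ a / suc n ℚ.+ + b / suc n)
    ≈⟨ ℚ.toℚᵘ-homo-+ (+ a / suc n) (+ b / suc n) ⟩
  ℚ.toℚᵘ (+ a / suc n) ℚᵘ.+ ℚ.toℚᵘ (+ b / suc n)
    ≈⟨ ℚᵘ.+-cong (ℚ.toℚᵘ-fromℚᵘ (mkℚᵘ (+ a) n)) (ℚ.toℚᵘ-fromℚᵘ (mkℚᵘ (+ b) n)) ⟩
  mkℚᵘ (+ a) n ℚᵘ.+ mkℚᵘ (+ b) n
    ≈⟨ ℚᵘ.*≡* (trans (cong (ℤ._* (+ suc n)) (sym (ℤ.*-distribʳ-+ (+ suc n) (+ a) (+ b))))
                (ℤ.*-assoc (+ (a + b)) (+ suc n) (+ suc n))) ⟩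
  mkℚᵘ (+ (a + b)) n
    ≈⟨ ℚ.toℚᵘ-fromℚᵘ (mkℚᵘ (+ (a + b)) n) ⟨
  ℚ.toℚᵘ (+ (a + b) / suc n) ∎)
  where open ℚᵘ.≃-Reasoning

archimedean : ∀ c ε → 0ℚ ℚ.< ε → ∃ λ N → ∀ n .{{_ : NonZero n}} → N ≤ n → + c / n ℚ.≤ ε
-- Here `ε` is (p + 1)/(q + 1), at least 1/(q + 1), so every positive `n` from c(q + 1) on will do.
archimedean c ε@(mkℚ (+ suc p) q _) _ = c * suc q , λ n le →
  subst (+ c / n ℚ.≤_) (ℚ.↥p/↧p≡p ε)
    (/-mono-cross c n (suc p) (suc q) (ℕ.≤-trans le (ℕ.m≤m+n n (p * n))))
archimedean c (mkℚ (+ zero) _ _)    (ℚ.*<* (ℤ.+<+ ()))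
archimedean c (mkℚ (ℤ.-[1+ _ ]) _ _) (ℚ.*<* ())

-- Lower bounds from a regular base graph

module Extremal {k} .{{_ : NonZero k}} (B : Digraph k) {d h} (H : Digraph h)
                (or : Oriented B) (reg : Regular d B) (no-hom : ∀ f → ¬ IsHom H B f) where

  open Blowup B

  -- A copy composed with `class` need not stay injective, hence `no-hom` speaks of all
  -- homomorphisms.
  blowup-free : ∀ n → ¬ Contains H (blowup n)
  blowup-free n (f , _ , hom) = no-hom (class ∘ f) hom

  blowup-g : ∀ n → (n ℕ./ k) * d ℕ.< g n H
  blowup-g n = ℕ.≰⇒> λ g≤ → blowup-free n
    (proj₁ (g-isLeast n H) (blowup n) (blowup-oriented or n)
      (ℕ.≤-trans g≤ (blowup-δ⁰ reg (n ℕ./ k) (m/n*n≤m n k))))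

  -- Rounding `n` down to a multiple of `k` lowers the degree bound by less than `d`, an error of
  -- `d / n` that vanishes in the limit.
  blowup-ratio : ∀ n .{{_ : NonZero n}} → + d / k ℚ.≤ ratio H n ℚ.+ + d / n
  blowup-ratio n@(suc _) = subst (+ d / k ℚ.≤_) (sym (/-distrib-+ (g n H) d n))
    (/-mono-cross d k (g n H + d) n (begin
      d * n
        ≤⟨ ℕ.*-monoʳ-≤ d (ℕ.≤-trans (ℕ.≤-reflexive (m≡m%n+[m/n]*n n k))
             (ℕ.+-monoˡ-≤ (m * k) (ℕ.<⇒≤ (m%n<n n k)))) ⟩
      d * (suc m * k)
        ≡⟨ ℕ.*-assoc d (suc m) k ⟨
      d * suc m * k
        ≡⟨ cong (_* k) (trans (ℕ.*-comm d (suc m)) (ℕ.+-comm d (m * d))) ⟩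
      (m * d + d) * k
        ≤⟨ ℕ.*-monoˡ-≤ k (ℕ.+-monoˡ-≤ d (ℕ.<⇒≤ (blowup-g n))) ⟩
      (g n H + d) * k ∎))
    where
    open ℕ.≤-Reasoning
    m = n ℕ./ k

  blowup-liminf : (+ d / k) ≤liminf ratio H
  blowup-liminf ε 0<ε with archimedean d ε 0<ε
  -- Starting at `suc N` keeps away from the junk value of `ratio` at 0.
  ... | N , small = suc N , λ where
    n@(suc _) (s≤s N≤n) → p≤q+r⇒p-r≤q
      (ℚ.≤-trans (blowup-ratio n) (ℚ.+-monoʳ-≤ (ratio H n) (small n (ℕ.m≤n⇒m≤1+n N≤n))))

  blowup-κ⁰ : κ⁰ H ≥ (+ d / k)
  blowup-κ⁰ = liminf≤limit (+ d / k) (ratio H) blowup-liminf , blowup-liminf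

  blowup-extremal : ∀ N → ∃ λ n → N ≤ n × ∃ λ e → k * e ≡ d * n ×
    ∃ λ (G : Digraph n) → Oriented G × Regular e G × ¬ Contains H G
  blowup-extremal N = N * k , ℕ.m≤m*n N k , N * d , k*[N*d]≡d*[N*k]
    , blowup (N * k) , blowup-oriented or (N * k) , blowup-regular reg N , blowup-free (N * k)
    where
    k*[N*d]≡d*[N*k] : k * (N * d) ≡ d * (N * k)
    k*[N*d]≡d*[N*k] = trans (sym (ℕ.*-assoc k N d))
      (trans (ℕ.*-comm (k * N) d) (cong (d *_) (ℕ.*-comm k N)))

-- Squares of cycles and paths

Transitive : ∀ {n} (G : Digraph n) (u v w : Fin n) → Set
Transitive G u v w = Edge G u v × Edge G v w × Edge G u w

square-transitive : ∀ {l k} (L : Digraph l) (G : Digraph k) {f} → Oriented L → IsHom (square L) G f →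
                    ∀ {u v w} → Edge L u v → Edge L v w → Transitive G (f u) (f v) (f w)
square-transitive L G or hom {u} {v} {w} uv vw =
    hom u v (inj₁ uv) , hom v w (inj₁ vw)
  -- The square has the arc from `u` to `w` only if they differ; were they equal, the two arcs would
  -- form a 2-cycle.
  , hom u w (inj₂ ((λ { refl → or uv vw }) , v , uv , vw))

path-oriented : ∀ l → Oriented (path l)
path-oriented l {u} {v} uv vu =
  ℕ.<-asym (ℕ.≤-reflexive (sym uv)) (ℕ.≤-reflexive (sym vu))

-- A wrap-around arc opposite to an ordinary one forces `l` to be 2, and two opposite wrap-around
-- arcs force it to be 1.
cycle-oriented : ∀ {l} → 3 ≤ l → Oriented (cycle l)
cycle-oriented 3≤l (inj₁ uv) (inj₁ vu) =
  ℕ.<-asym (ℕ.≤-reflexive (sym uv)) (ℕ.≤-reflexive (sym vu))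
cycle-oriented 3≤l (inj₁ uv) (inj₂ (v-last , u-zero)) =
  ℕ.<⇒≢ 3≤l (trans (cong (λ m → suc (suc m)) (sym u-zero)) (trans (cong suc (sym uv)) v-last))
cycle-oriented 3≤l (inj₂ (u-last , v-zero)) (inj₁ vu) =
  ℕ.<⇒≢ 3≤l (trans (cong (λ m → suc (suc m)) (sym v-zero)) (trans (cong suc (sym vu)) u-last))
cycle-oriented 3≤l (inj₂ (u-last , v-zero)) (inj₂ (v-last , u-zero)) =
  ℕ.<⇒≢ (ℕ.<-trans (s≤s (s≤s z≤n)) 3≤l) (trans (cong suc (sym u-zero)) u-last)

%-+-cong : ∀ d .{{_ : NonZero d}} a {b c} → b % d ≡ c % d → (a + b) % d ≡ (a + c) % d
%-+-cong d a {b} {c} eq = trans (%-distribˡ-+ a b d)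
  (trans (cong (λ x → (a % d + x) % d) eq) (sym (%-distribˡ-+ a c d)))

-- This unrolls the cycle into an infinite walk, so that phases can be followed by induction on ℕ.
mod-cycle-edge : ∀ l .{{_ : NonZero l}} i → Edge (cycle l) (i mod l) (suc i mod l)
mod-cycle-edge l i with ℕ.m≤n⇒m<n∨m≡n (m%n<n i l)
... | inj₁ lt = inj₁ (trans (toℕ-fromℕ< (m%n<n (suc i) l))
        (trans (sym (%-+-cong l 1 (m%n%n≡m%n i l)))
          (trans (m<n⇒m%n≡m lt) (cong suc (sym (toℕ-fromℕ< (m%n<n i l)))))))
... | inj₂ eq = inj₂
      ( trans (cong suc (toℕ-fromℕ< (m%n<n i l))) eq
      , trans (toℕ-fromℕ< (m%n<n (suc i) l))
        (trans (sym (%-+-cong l 1 (m%n%n≡m%n i l))) (trans (cong (_% l) eq) (n%n≡0 l))))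

-- The phase of the arcs of a closed square walk increases by its length in one turn.
phase⇒no-cycle-square :
  ∀ {k} (B : Digraph k) d .{{_ : NonZero d}} (φ : Fin k → Fin k → ℕ) →
  (∀ u v w → Transitive B u v w → φ v w % d ≡ suc (φ u v) % d) →
  ∀ {l} → 3 ≤ l → l % d ≢ 0 → ∀ f → ¬ IsHom (square (cycle l)) B f
phase⇒no-cycle-square {k} B d@(suc d-1) φ rises {l@(suc _)} 3≤l l≢0 f hom = l≢0 (begin
  -- One turn gives l + c ≡ c modulo d. Adding (d - 1)c to both sides completes c to a multiple of
  -- d, which cancels it without subtraction.
  l % d                        ≡⟨ [m+kn]%n≡m%n l c d ⟨
  (l + c * d) % d              ≡⟨ cong (λ x → (l + x) % d) c*d≡ ⟩
  (l + (d-1 * c + c)) % d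
    ≡⟨ cong (_% d) (CommutativeSemigroup.x∙yz≈y∙xz ℕ.+-commutativeSemigroup l (d-1 * c) c) ⟩
  (d-1 * c + (l + c)) % d      ≡⟨ %-+-cong d (d-1 * c) (trans (sym (Φ-% l)) (cong (_% d) Φ-period)) ⟩
  (d-1 * c + c) % d            ≡⟨ cong (_% d) (sym c*d≡) ⟩
  (c * d) % d                  ≡⟨ m*n%n≡0 c d ⟩
  0                            ∎)
  where
  open ≡-Reasoning
  h : ℕ → Fin k
  h i = f (i mod l)
  Φ : ℕ → ℕ
  Φ i = φ (h i) (h (suc i))
  c = Φ 0
  c*d≡ : c * d ≡ d-1 * c + c
  c*d≡ = trans (ℕ.*-comm c d) (ℕ.+-comm c (d-1 * c))
  Φ-% : ∀ i → Φ i % d ≡ (i + c) % d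
  Φ-% zero    = refl
  Φ-% (suc i) = trans
    (rises _ _ _ (square-transitive (cycle l) B (cycle-oriented 3≤l) hom
      (mod-cycle-edge l i) (mod-cycle-edge l (suc i))))
    (%-+-cong d 1 (Φ-% i))
  Φ-period : Φ l ≡ Φ 0
  Φ-period = cong₂ (λ i j → φ (f i) (f j))
    (mod-cong l l 0 ([m+n]%n≡m%n 0 l)) (mod-cong l (suc l) 1 ([m+n]%n≡m%n 1 l))

-- Two extremal base graphs

fromOutNeighbours : ∀ {k} → Vec (List (Fin k)) k → Digraph k
fromOutNeighbours ns .Edge  u v = v ∈ Vec.lookup ns u
fromOutNeighbours ns .edge? u v = DecMembership._∈?_ Fin._≟_ v (Vec.lookup ns u)

-- The inner triangles are {0, 1, 2}, {3, 4, 5} and {6, 7, 8}, so division by 3 recovers the inner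
-- triangle of a vertex.
triangleOfTriangles : Digraph 9
triangleOfTriangles = fromOutNeighbours
  ( (# 1 ∷ # 3 ∷ # 4 ∷ # 5 ∷ [])
  ∷ (# 2 ∷ # 3 ∷ # 4 ∷ # 5 ∷ [])
  ∷ (# 0 ∷ # 3 ∷ # 4 ∷ # 5 ∷ [])
  ∷ (# 4 ∷ # 6 ∷ # 7 ∷ # 8 ∷ [])
  ∷ (# 5 ∷ # 6 ∷ # 7 ∷ # 8 ∷ [])
  ∷ (# 3 ∷ # 6 ∷ # 7 ∷ # 8 ∷ [])
  ∷ (# 7 ∷ # 0 ∷ # 1 ∷ # 2 ∷ [])
  ∷ (# 8 ∷ # 0 ∷ # 1 ∷ # 2 ∷ [])
  ∷ (# 6 ∷ # 0 ∷ # 1 ∷ # 2 ∷ [])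
  ∷ [])

-- Two oppositely oriented triangles A = 0 → 1 → 2 → 0 and B = 3 → 5 → 4 → 3 and a pair
-- P = {6, 7}, with all arcs B → P → A and all arcs A → B except the matching i → 3 + i.
-- The matching breaks the square walks: the longest ones have the types PAAB and ABBP.
twoTrianglesAndPair : Digraph 8
twoTrianglesAndPair = fromOutNeighbours
  ( (# 1 ∷ # 4 ∷ # 5 ∷ [])
  ∷ (# 2 ∷ # 3 ∷ # 5 ∷ [])
  ∷ (# 0 ∷ # 3 ∷ # 4 ∷ [])
  ∷ (# 5 ∷ # 6 ∷ # 7 ∷ [])
  ∷ (# 3 ∷ # 6 ∷ # 7 ∷ [])
  ∷ (# 4 ∷ # 6 ∷ # 7 ∷ [])
  ∷ (# 0 ∷ # 1 ∷ # 2 ∷ [])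
  ∷ (# 0 ∷ # 1 ∷ # 2 ∷ [])
  ∷ [])

oriented? : ∀ {n} (G : Digraph n) → U.Decidable (λ u → ∀ v → Edge G u v → ¬ Edge G v u)
oriented? G u = all? λ v → edge? G u v →-dec ¬? (edge? G v u)

regular? : ∀ {n} d (G : Digraph n) → U.Decidable (λ v → indeg G v ≡ d × outdeg G v ≡ d)
regular? d G v = (indeg G v ℕ.≟ d) ×-dec (outdeg G v ℕ.≟ d)

triangleOfTriangles-oriented : Oriented triangleOfTriangles
triangleOfTriangles-oriented {u} {v} = from-yes (all? (oriented? triangleOfTriangles)) u v

triangleOfTriangles-regular : Regular 4 triangleOfTriangles
triangleOfTriangles-regular = from-yes (all? (regular? 4 triangleOfTriangles))

twoTrianglesAndPair-oriented : Oriented twoTrianglesAndPair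
twoTrianglesAndPair-oriented {u} {v} = from-yes (all? (oriented? twoTrianglesAndPair)) u v

twoTrianglesAndPair-regular : Regular 3 twoTrianglesAndPair
twoTrianglesAndPair-regular = from-yes (all? (regular? 3 twoTrianglesAndPair))

-- 2a for an arc inside the a-th inner triangle and 2a + 1 for an arc leaving it: a transitive
-- triangle u → v → w has exactly one of uv, vw inside an inner triangle.
phase : Fin 9 → Fin 9 → ℕ
phase u v = 2 * (toℕ u ℕ./ 3) + (if does (toℕ u ℕ./ 3 ℕ.≟ toℕ v ℕ./ 3) then 0 else 1)

-- Two consecutive arcs that both stay inside, or both leave, are closed by an arc from `w` back to
-- `u`. Otherwise staying then leaving takes 2a to 2a + 1, and leaving then staying takes 2a + 1 to
-- 2(a + 1), with a counted modulo 3.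
phase-rises : ∀ u v w → Transitive triangleOfTriangles u v w →
              phase v w % 6 ≡ suc (phase u v) % 6
phase-rises u v w (uv , vw , uw) = check u v uv w vw uw
  where
  T = triangleOfTriangles
  -- Each arc is required as soon as its ends are chosen, so the exhaustive search only extends
  -- partial walks.
  check : ∀ u v → Edge T u v → ∀ w → Edge T v w → Edge T u w →
          phase v w % 6 ≡ suc (phase u v) % 6
  check = from-yes (all? λ u → all? λ v → edge? T u v →-dec all? λ w →
    edge? T v w →-dec edge? T u w →-dec (phase v w % 6 ℕ.≟ suc (phase u v) % 6))

-- Transitive triangles have the types PAA, AAB, ABB and BBP only, so a square walk on 5 vertices
-- would contain AABB. With indices modulo 3, its vertices in A are i and i + 1; avoiding the
-- matching makes the next vertex 3 + (i + 2), whose successor in B is 3 + (i + 1), the match of i +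
-- 1. The code checks this exhaustively.
no-square-walk-on-5 : ∀ a b c d e → Transitive twoTrianglesAndPair a b c →
  Transitive twoTrianglesAndPair b c d → ¬ Transitive twoTrianglesAndPair c d e
no-square-walk-on-5 a b c d e (ab , bc , ac) (_ , cd , bd) (_ , de , ce) =
  check a b ab c bc ac d cd bd e de ce
  where
  T = twoTrianglesAndPair
  check : ∀ a b → Edge T a b → ∀ c → Edge T b c → Edge T a c →
          ∀ d → Edge T c d → Edge T b d → ∀ e → Edge T d e → ¬ Edge T c e
  check = from-yes (all? λ a → all? λ b → edge? T a b →-dec all? λ c →
    edge? T b c →-dec edge? T a c →-dec all? λ d → edge? T c d →-dec edge? T b d →-dec
    all? λ e → edge? T d e →-dec ¬? (edge? T c e))

no-path-square : ∀ {l} → 5 ≤ l → ∀ f → ¬ IsHom (square (path l)) twoTrianglesAndPair f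
no-path-square (s≤s (s≤s (s≤s (s≤s (s≤s _))))) f hom = no-square-walk-on-5
  (f zero) (f (suc zero)) (f (suc (suc zero))) (f (suc (suc (suc zero))))
  (f (suc (suc (suc (suc zero)))))
  (triangle {zero} {suc zero} {suc (suc zero)} refl refl)
  (triangle {suc zero} {suc (suc zero)} {suc (suc (suc zero))} refl refl)
  (triangle {suc (suc zero)} {suc (suc (suc zero))} {suc (suc (suc (suc zero)))} refl refl)
  where
  triangle : ∀ {u v w} → Edge (path _) u v → Edge (path _) v w →
             Transitive twoTrianglesAndPair (f u) (f v) (f w)
  triangle = square-transitive (path _) twoTrianglesAndPair (path-oriented _) hom

proposition1p3 : ((∀ l → 5 ≤ l → l % 6 ≢ 0 → κ⁰ square (cycle l) ≥ (+ 4 / 9))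
    × (∀ l → 7 ≤ l → κ⁰ square (path l) ≥ (+ 3 / 8)))
    ×
    ((∀ l → 5 ≤ l → l % 6 ≢ 0 →
    ∀ N → ∃ λ n → N ≤ n × ∃ λ d → 9 * d ≡ 4 * n ×
    ∃ λ (G : Digraph n) →
    Oriented G × Regular d G × ¬ Contains (square (cycle l)) G)
    × (∀ l → 7 ≤ l →
    ∀ N → ∃ λ n → N ≤ n × ∃ λ d → 8 * d ≡ 3 * n ×
    ∃ λ (G : Digraph n) →
    Oriented G × Regular d G × ¬ Contains (square (path l)) G))
proposition1p3 =
    ( (λ l 5≤l 6∤l → cycles.blowup-κ⁰ l (no-cycle 5≤l 6∤l))
    , (λ l 7≤l → paths.blowup-κ⁰ l (no-path 7≤l)))
  , ( (λ l 5≤l 6∤l → cycles.blowup-extremal l (no-cycle 5≤l 6∤l))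
    , (λ l 7≤l → paths.blowup-extremal l (no-path 7≤l)))
  where
  module cycles l = Extremal triangleOfTriangles (square (cycle l))
                      triangleOfTriangles-oriented triangleOfTriangles-regular
  module paths l = Extremal twoTrianglesAndPair (square (path l))
                     twoTrianglesAndPair-oriented twoTrianglesAndPair-regular
  no-cycle : ∀ {l} → 5 ≤ l → l % 6 ≢ 0 → ∀ f → ¬ IsHom (square (cycle l)) triangleOfTriangles f
  no-cycle 5≤l = phase⇒no-cycle-square triangleOfTriangles 6 phase phase-rises (ℕ.≤-trans (ℕ.m≤m+n 3 2) 5≤l)
  no-path : ∀ {l} → 7 ≤ l → ∀ f → ¬ IsHom (square (path l)) twoTrianglesAndPair f
  no-path 7≤l = no-path-square (ℕ.≤-trans (ℕ.m≤m+n 5 2) 7≤l)
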